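{- Let $G$ be a maximal outerplanar graph. Then $G$ is in $B_0$ if and only if $G$ does not contain an induced subgraph isomorphic to $S_3$.
   Context: A graph is maximal outerplanar if it is outerplanar and adding any single new edge yields a non-outerplanar graph. $S_3$ is the graph with vertices $x_1,x_2,x_3,y_1,y_2,y_3$ and edges $\{x_1,x_2\},\{x_1,x_3\},\{x_2,x_3\},\{x_1,y_1\},\{x_2,y_1\},\{x_2,y_2\},\{x_3,y_2\},\{x_3,y_3\},\{x_1,y_3\}$. An EPG representation of a graph is a set of paths on a rectangular grid (sequences of grid points joined consecutively by grid edges), one per vertex, such that two vertices are adjacent iff their paths share a grid edge. $B_0$ is the class of graphs having an EPG representation in which no path has a bend (every path lies on a single grid line). -}

module Defs where

open import Data.Fin using (Fin; _<_; #_)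
open import Data.Fin.Permutation using (Permutation′; _⟨$⟩ʳ_)
open import Data.Fin.Properties using (_≟_; all?)
open import Data.Integer using (ℤ) renaming (suc to sucℤ)
open import Data.List using (List; []; _∷_)
open import Data.List.NonEmpty using (List⁺; toList)
open import Data.List.Membership.Propositional using (_∈_)
open import Data.List.Relation.Binary.Infix.Heterogeneous using (Infix)
open import Data.List.Relation.Unary.Linked using (Linked)
open import Data.Nat using (ℕ)
open import Data.Product using (Σ; ∃-syntax; _×_; _,_)
open import Data.Product.Properties using (≡-dec)
open import Data.Sum using (_⊎_; inj₁; inj₂; [_,_]; swap)
open import Function.Bundles using (_⇔_)
open import Function.Definitions using (Injective)
open import Relation.Binary using (Decidable; Symmetric)
open import Relation.Binary.PropositionalEquality using (_≡_; _≢_; sym; trans)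
open import Relation.Nullary using (¬_)
open import Relation.Nullary.Decidable using (_×-dec_; _⊎-dec_; ¬?; toWitness)

import Data.List.Membership.DecPropositional as DecMembership

record Graph (n : ℕ) : Set₁ where
  infix 4 _~_ _~?_
  field
    _~_    : Fin n → Fin n → Set
    _~?_   : Decidable _~_
    ~-sym  : Symmetric _~_
    ~-irr  : ∀ u → ¬ (u ~ u)

addEdge : ∀ {n} (G : Graph n) (u v : Fin n) → u ≢ v → Graph n
addEdge G u v u≢v = record
  { _~_   = λ a b → (a ~ b) ⊎ ((a ≡ u × b ≡ v) ⊎ (a ≡ v × b ≡ u))
  ; _~?_  = λ a b → (a ~? b) ⊎-dec (((a ≟ u) ×-dec (b ≟ v)) ⊎-dec ((a ≟ v) ×-dec (b ≟ u)))
  ; ~-sym = λ { (inj₁ e)                 → inj₁ (~-sym e)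
              ; (inj₂ (inj₁ (p , q)))    → inj₂ (inj₂ (q , p))
              ; (inj₂ (inj₂ (p , q)))    → inj₂ (inj₁ (q , p)) }
  ; ~-irr = λ { a (inj₁ e)               → ~-irr a e
              ; a (inj₂ (inj₁ (p , q)))  → u≢v (trans (sym p) q)
              ; a (inj₂ (inj₂ (p , q)))  → u≢v (trans (sym q) p) }
  }
  where open Graph G

-- H is isomorphic to the subgraph of G induced by the image of the
-- injection.
_IsInducedIn_ : ∀ {m n} → Graph m → Graph n → Set
_IsInducedIn_ {m} {n} H G =
  ∃[ f ] Injective {A = Fin m} {B = Fin n} _≡_ _≡_ f
       × (∀ u v → (Graph._~_ H u v) ⇔ (Graph._~_ G (f u) (f v)))

-- A plane drawing with all vertices on the outer face is given as a
-- drawing in a disc with all vertices on the bounding circle and the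
-- edges as chords.  The permutation gives the positions of the
-- vertices along the circle, which is cut open between the last and
-- the first position.  Two chords cross iff their endpoints
-- alternate; by symmetry of _~_ it suffices to exclude the pattern
-- a c b d.
NonCrossing : ∀ {n} → Graph n → Permutation′ n → Set
NonCrossing G π = ∀ {a b c d} → a ~ b → c ~ d →
  ¬ ((π ⟨$⟩ʳ a) < (π ⟨$⟩ʳ c) × (π ⟨$⟩ʳ c) < (π ⟨$⟩ʳ b) × (π ⟨$⟩ʳ b) < (π ⟨$⟩ʳ d))
  where open Graph G

Outerplanar : ∀ {n} → Graph n → Set
Outerplanar {n} G = Σ (Permutation′ n) (NonCrossing G)

MaximalOuterplanar : ∀ {n} → Graph n → Set
MaximalOuterplanar G =
  Outerplanar G × (∀ u v (u≢v : u ≢ v) → ¬ (u ~ v) → ¬ Outerplanar (addEdge G u v u≢v))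
  where open Graph G

S₃-edges : List (Fin 6 × Fin 6)
S₃-edges = (x₁ , x₂) ∷ (x₁ , x₃) ∷ (x₂ , x₃)
         ∷ (x₁ , y₁) ∷ (x₂ , y₁)
         ∷ (x₂ , y₂) ∷ (x₃ , y₂)
         ∷ (x₃ , y₃) ∷ (x₁ , y₃) ∷ []
  where
  x₁ x₂ x₃ y₁ y₂ y₃ : Fin 6
  x₁ = # 0
  x₂ = # 1
  x₃ = # 2
  y₁ = # 3
  y₂ = # 4
  y₃ = # 5

S₃ : Graph 6
S₃ = record
  { _~_   = λ u v → (u , v) ∈ S₃-edges ⊎ (v , u) ∈ S₃-edges
  ; _~?_  = λ u v → ((u , v) ∈? S₃-edges) ⊎-dec ((v , u) ∈? S₃-edges)
  ; ~-sym = swap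
  ; ~-irr = λ u → [ no-loops u , no-loops u ]
  }
  where
  open DecMembership (≡-dec (_≟_ {6}) (_≟_ {6})) using (_∈?_)

  no-loops : ∀ u → ¬ ((u , u) ∈ S₃-edges)
  no-loops = toWitness {a? = all? λ u → ¬? ((u , u) ∈? S₃-edges)} _

Point : Set
Point = ℤ × ℤ

UnitStep : ℤ → ℤ → Set
UnitStep i j = j ≡ sucℤ i ⊎ i ≡ sucℤ j

Horizontal : Point → Point → Set
Horizontal (x , y) (x′ , y′) = UnitStep x x′ × y ≡ y′

Vertical : Point → Point → Set
Vertical (x , y) (x′ , y′) = x ≡ x′ × UnitStep y y′

GridEdge : Point → Point → Set
GridEdge p q = Horizontal p q ⊎ Vertical p q

record GridPath : Set where
  field
    points : List⁺ Point
    linked : Linked GridEdge (toList points)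

Occurs : List Point → GridPath → Set
Occurs ps P = Infix _≡_ ps (toList (GridPath.points P))

-- Grid edges are undirected: a path may traverse {p , q} either way.
Uses : GridPath → Point → Point → Set
Uses P p q = Occurs (p ∷ q ∷ []) P ⊎ Occurs (q ∷ p ∷ []) P

ShareEdge : GridPath → GridPath → Set
ShareEdge P Q = ∃[ p ] ∃[ q ] (Uses P p q × Uses Q p q)

HasBend : GridPath → Set
HasBend P = ∃[ p ] ∃[ q ] ∃[ r ] (Occurs (p ∷ q ∷ r ∷ []) P
  × ((Horizontal p q × Vertical q r) ⊎ (Vertical p q × Horizontal q r)))

record EPGRepresentation {n : ℕ} (G : Graph n) : Set where
  open Graph G
  field
    path     : Fin n → GridPath
    adjacent : ∀ u v → u ≢ v → (u ~ v) ⇔ ShareEdge (path u) (path v)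

B₀ : ∀ {n} → Graph n → Set
B₀ G = Σ (EPGRepresentation G) λ R → ∀ v → ¬ HasBend (EPGRepresentation.path R v)

{-# OPTIONS --safe #-}
-- Bendless grid paths are intervals on a line.  In S₃ the paths of y₁, y₂, y₃
-- are pairwise disjoint, so one lies between the other two; the xᵢ adjacent to
-- these two then meets it, which is impossible.
--
-- Conversely, put the vertices on a circle.  By maximality every non-edge is
-- crossed by an edge, so the graph is a triangulated polygon.  Without S₃ no
-- triangle has neighbouring triangles on all three sides, so the triangles form
-- a strip, and each vertex occupies an interval of consecutive triangles.
module Submission where

open import Defs
open import Data.Empty using (⊥)
open import Data.Fin using (Fin; #_; toℕ)
open import Data.Fin.Permutation using (Permutation′; _⟨$⟩ʳ_)
open import Data.Fin.Properties using (_≟_; all?; any?; toℕ-injective)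
open import Data.Integer using (ℤ; +_; -[1+_]; 0ℤ; ∣_∣; _-_; +≤+; -≤-; -≤+) renaming (suc to sucℤ; _+_ to _+ᶻ_; _≤_ to _≤ᶻ_; _<_ to _<ᶻ_; _≤?_ to _≤ᶻ?_)
import Data.Integer.Properties as ℤ
open import Data.List using (List; []; _∷_; map; filter; allFin)
open import Data.List.Extrema.Nat using (argmin; argmax; argmin-all; argmax-all; f[argmin]≤f[xs]; f[xs]≤f[argmax])
open import Data.List.NonEmpty using (List⁺; toList; _∷_)
open import Data.List.Membership.Propositional using (_∈_)
open import Data.List.Membership.Propositional.Properties using (∈-filter⁺; ∈-allFin)
import Data.List.Membership.DecPropositional as DecMembership
open import Data.List.Relation.Binary.Infix.Heterogeneous using (Infix; here; there)
open import Data.List.Relation.Binary.Prefix.Heterogeneous using ([]; _∷_)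
open import Data.List.Relation.Unary.All as All using (All; []; _∷_)
open import Data.List.Relation.Unary.All.Properties using (all-filter)
open import Data.List.Relation.Unary.Any using (here; there)
open import Data.List.Relation.Unary.Linked as Linked using (Linked; []; [-]; _∷_)
import Data.List.Relation.Unary.Linked.Properties as Linked
open import Data.Nat using (ℕ; zero; suc; _+_; _≤_; _<_; z≤n; s≤s; s≤s⁻¹; _<?_; _≤?_)
import Data.Nat.Properties as ℕ
open import Data.Product using (Σ; ∃-syntax; _×_; _,_; proj₁; proj₂) renaming (swap to ×-swap)
open import Data.Product.Function.NonDependent.Propositional using (_×-⇔_)
open import Data.Product.Properties using (≡-dec)
open import Data.Sum as Sum using (_⊎_; inj₁; inj₂; swap; [_,_])
open import Data.Unit using (⊤; tt)
open import Data.Vec using ([]; _∷_; lookup)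
open import Function using (_∘_)
open import Function.Bundles using (_⇔_; mk⇔; Equivalence; module Injection)
open import Function.Construct.Composition using (_⇔-∘_)
open import Function.Construct.Symmetry using (⇔-sym)
open import Function.Properties.Inverse using (↔⇒↣)
open import Relation.Binary using (tri<; tri≈; tri>)
open import Relation.Binary.PropositionalEquality using (_≡_; _≢_; refl; sym; trans; cong; subst; ≢-sym; module ≡-Reasoning)
open import Relation.Nullary using (¬_; Dec; yes; no; contradiction)
open import Relation.Nullary.Decidable using (True; False; _×-dec_; _⊎-dec_; toWitness; toWitnessFalse; decidable-stable)
open import Relation.Unary using (Decidable)

-- Walks in ℤ

-- A chord can be followed inwards only when the triangle on its outer side is known: the vertex `z`
-- there is what turns the absence of `S₃` into the statement that one of the two remaining sides of
-- the inner triangle is a side of the polygon. The chord from the first to the last position has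
-- nothing beyond it, so its triangle may continue on both sides; hence two strips, glued there. A
-- strip is built from its far end towards its chord, so the invariant to carry is that both ends of
-- the chord sit at the extreme position 0, where the next triangle is put in front. In the other
-- direction, grid paths may backtrack, so they are reduced to convex sets of unit edges on a line
-- before anything is compared.

Consecutive : {A : Set} → A → A → List A → Set
Consecutive a b as = Infix _≡_ (a ∷ b ∷ []) as

Traverses : {A : Set} → A → A → List A → Set
Traverses a b as = Consecutive a b as ⊎ Consecutive b a as

consecutive-∈ : {A : Set} {a b : A} {as : List A} → Consecutive a b as → a ∈ as × b ∈ as
consecutive-∈ (here (refl ∷ refl ∷ [])) = here refl , there (here refl)
consecutive-∈ (there i) with p , q ← consecutive-∈ i = there p , there q

traverses-∈ : {A : Set} {a b : A} {as : List A} → Traverses a b as → a ∈ as × b ∈ as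
traverses-∈ (inj₁ i) = consecutive-∈ i
traverses-∈ (inj₂ i) with p , q ← consecutive-∈ i = q , p

traverses-there : {A : Set} {a b c : A} {as : List A} → Traverses a b as → Traverses a b (c ∷ as)
traverses-there = Sum.map there there

consecutive-linked : {A : Set} {R : A → A → Set} {a b : A} {as : List A} →
                     Linked R as → Consecutive a b as → R a b
consecutive-linked (r ∷ _)  (here (refl ∷ refl ∷ [])) = r
consecutive-linked [-]      (here (refl ∷ ()))
consecutive-linked (_ ∷ rs) (there i)                 = consecutive-linked rs i
consecutive-linked [-]      (there (here ()))
consecutive-linked []       (here ())

module _ {A B : Set} (f : A → B) where

  consecutive-map⁺ : {a b : A} {as : List A} → Consecutive a b as → Consecutive (f a) (f b) (map f as)
  consecutive-map⁺ (here (refl ∷ refl ∷ [])) = here (refl ∷ refl ∷ [])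
  consecutive-map⁺ (there i)                 = there (consecutive-map⁺ i)

  consecutive-map⁻ : {x y : B} (as : List A) → Consecutive x y (map f as) →
                     ∃[ a ] ∃[ b ] (x ≡ f a × y ≡ f b × Consecutive a b as)
  consecutive-map⁻ (a ∷ b ∷ _) (here (refl ∷ refl ∷ [])) = a , b , refl , refl , here (refl ∷ refl ∷ [])
  consecutive-map⁻ (a ∷ [])    (here (refl ∷ ()))
  consecutive-map⁻ []          (here ())
  consecutive-map⁻ (_ ∷ as)    (there i) with a , b , p , q , j ← consecutive-map⁻ as i =
    a , b , p , q , there j

unitStep-sym : ∀ {i j} → UnitStep i j → UnitStep j i
unitStep-sym = swap

unitStep-irrefl : ∀ {i} → ¬ UnitStep i i
unitStep-irrefl = Sum.[ ℤ.i≢suc[i] , ℤ.i≢suc[i] ]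

i<suc[j]⇒i≤j : ∀ {i j} → i <ᶻ sucℤ j → i ≤ᶻ j
i<suc[j]⇒i≤j {i} {j} i<1+j = subst (i ≤ᶻ_) (ℤ.pred-suc j) (ℤ.i<j⇒i≤pred[j] i<1+j)

i≤j⇒i<suc[j] : ∀ {i j} → i ≤ᶻ j → i <ᶻ sucℤ j
i≤j⇒i<suc[j] = ℤ.suc[i]≤j⇒i<j ∘ ℤ.suc-mono

unitStep-straddles : ∀ {i k j} → UnitStep i k → i ≤ᶻ j → j <ᶻ k → i ≡ j × k ≡ sucℤ j
unitStep-straddles (inj₁ refl) i≤j j<1+i with refl ← ℤ.≤-antisym i≤j (i<suc[j]⇒i≤j j<1+i) = refl , refl
unitStep-straddles {k = k} (inj₂ refl) 1+k≤j j<k =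
  contradiction (ℤ.≤-<-trans 1+k≤j j<k) (ℤ.≤⇒≯ (ℤ.i≤suc[i] k))

-- A discrete intermediate value theorem: unit steps can pass between the integers up to `j` and
-- those above `j` only along the edge from `j` to `j + 1`.
traverses-or-one-side : ∀ j {xs} → Linked UnitStep xs →
  Traverses j (sucℤ j) xs ⊎ All (_≤ᶻ j) xs ⊎ All (j <ᶻ_) xs
traverses-or-one-side j [] = inj₂ (inj₁ [])
traverses-or-one-side j {x ∷ _} [-] with x ≤ᶻ? j
... | yes x≤j = inj₂ (inj₁ (x≤j ∷ []))
... | no  x≰j = inj₂ (inj₂ (ℤ.≰⇒> x≰j ∷ []))
traverses-or-one-side j {x ∷ y ∷ xs} (s ∷ ss) with traverses-or-one-side j ss | x ≤ᶻ? j
... | inj₁ t                 | _       = inj₁ (traverses-there t)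
... | inj₂ (inj₁ ≤j)         | yes x≤j = inj₂ (inj₁ (x≤j ∷ ≤j))
... | inj₂ (inj₂ >j)         | no  x≰j = inj₂ (inj₂ (ℤ.≰⇒> x≰j ∷ >j))
... | inj₂ (inj₁ (y≤j ∷ _)) | no  x≰j
  with refl , refl ← unitStep-straddles (unitStep-sym s) y≤j (ℤ.≰⇒> x≰j) =
  inj₁ (inj₂ (here (refl ∷ refl ∷ [])))
... | inj₂ (inj₂ (j<y ∷ _)) | yes x≤j
  with refl , refl ← unitStep-straddles s x≤j j<y = inj₁ (inj₁ (here (refl ∷ refl ∷ [])))

traverses-between : ∀ {i j k xs} → Linked UnitStep xs → i ∈ xs → k ∈ xs → i ≤ᶻ j → j <ᶻ k →
                    Traverses j (sucℤ j) xs
traverses-between {j = j} ss i∈xs k∈xs i≤j j<k with traverses-or-one-side j ss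
... | inj₁ t         = t
... | inj₂ (inj₁ ≤j) = contradiction (All.lookup ≤j k∈xs) (ℤ.<⇒≱ j<k)
... | inj₂ (inj₂ >j) = contradiction (All.lookup >j i∈xs) (ℤ.≤⇒≯ i≤j)

Convex : (ℤ → Set) → Set
Convex X = ∀ {i j k} → X i → X k → i ≤ᶻ j → j ≤ᶻ k → X j

-- A walk using the edges at `i` and at `k` visits `i` and `k + 1`, and so crosses every edge in
-- between.
traverses-convex : ∀ {xs} → Linked UnitStep xs → Convex (λ j → Traverses j (sucℤ j) xs)
traverses-convex ss ti tk i≤j j≤k =
  traverses-between ss (proj₁ (traverses-∈ ti)) (proj₂ (traverses-∈ tk)) i≤j (i≤j⇒i<suc[j] j≤k)

-- Straight paths

data Axis : Set where
  horizontal vertical : Axis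

Line : Set
Line = Axis × ℤ

pointOn : Line → ℤ → Point
pointOn (horizontal , y) i = i , y
pointOn (vertical   , x) i = x , i

record Straight (P : GridPath) : Set where
  field
    line   : Line
    walk   : List ℤ
    unit   : Linked UnitStep walk
    traced : toList (GridPath.points P) ≡ map (pointOn line) walk

  -- A grid edge of the line is named by its lower end, so that sets of edges become sets of
  -- integers.
  Covers : ℤ → Set
  Covers j = Traverses j (sucℤ j) walk

  uses⁺ : ∀ {i k} → Traverses i k walk → Uses P (pointOn line i) (pointOn line k)
  uses⁺ rewrite traced = Sum.map (consecutive-map⁺ (pointOn line)) (consecutive-map⁺ (pointOn line))

  uses⁻ : ∀ {p q} → Uses P p q →
          ∃[ i ] ∃[ k ] (p ≡ pointOn line i × q ≡ pointOn line k × UnitStep i k × Traverses i k walk)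
  uses⁻ u rewrite traced with u
  ... | inj₁ c with i , k , p≡ , q≡ , t ← consecutive-map⁻ (pointOn line) walk c =
    i , k , p≡ , q≡ , consecutive-linked unit t , inj₁ t
  ... | inj₂ c with k , i , q≡ , p≡ , t ← consecutive-map⁻ (pointOn line) walk c =
    i , k , p≡ , q≡ , unitStep-sym (consecutive-linked unit t) , inj₂ t

  covers-convex : Convex Covers
  covers-convex = traverses-convex unit

open Straight using (line; Covers; covers-convex)

-- A horizontal and a vertical line may share one point, but not two distinct ones; `UnitStep` keeps
-- the two points apart.
pointOn-injective : ∀ ℓ ℓ′ {i k i′ k′} → UnitStep i k →
  pointOn ℓ i ≡ pointOn ℓ′ i′ → pointOn ℓ k ≡ pointOn ℓ′ k′ → ℓ ≡ ℓ′ × i ≡ i′ × k ≡ k′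
pointOn-injective (horizontal , _) (horizontal , _) s refl refl = refl , refl , refl
pointOn-injective (vertical   , _) (vertical   , _) s refl refl = refl , refl , refl
pointOn-injective (horizontal , _) (vertical   , _) s refl refl = contradiction s unitStep-irrefl
pointOn-injective (vertical   , _) (horizontal , _) s refl refl = contradiction s unitStep-irrefl

module _ {P Q : GridPath} (p : Straight P) (q : Straight Q) where

  share⁺ : line p ≡ line q → ∀ {j} → Covers p j → Covers q j → ShareEdge P Q
  share⁺ ℓ≡ cp cq =
    _ , _ , Straight.uses⁺ p cp , subst (λ ℓ → Uses Q (pointOn ℓ _) (pointOn ℓ _)) (sym ℓ≡) (Straight.uses⁺ q cq)

  share⁻ : ShareEdge P Q → line p ≡ line q × ∃[ j ] (Covers p j × Covers q j)
  share⁻ (_ , _ , up , uq)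
    with i , k , refl , refl , s , tp ← Straight.uses⁻ p up
    with i′ , k′ , e , e′ , _ , tq ← Straight.uses⁻ q uq
    with ℓ≡ , refl , refl ← pointOn-injective (line p) (line q) s e e′
    with s
  ... | inj₁ refl = ℓ≡ , i , tp , tq
  ... | inj₂ refl = ℓ≡ , k , swap tp , swap tq

-- The first edge of the tail fixes an axis, and a new edge along the other axis would be a bend.
-- Two-point paths form a separate base case because a single point does not determine an axis; on
-- its own it is given the horizontal one.
straighten : (ps : List⁺ Point) (l : Linked GridEdge (toList ps)) →
             ¬ HasBend (record { points = ps ; linked = l }) → Straight (record { points = ps ; linked = l })
straighten ((x , y) ∷ []) l _ = record { line = horizontal , y ; walk = x ∷ [] ; unit = [-] ; traced = refl }
straighten ((x , y) ∷ (x′ , y) ∷ []) (inj₁ (s , refl) ∷ [-]) _ =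
  record { line = horizontal , y ; walk = x ∷ x′ ∷ [] ; unit = s ∷ [-] ; traced = refl }
straighten ((x , y) ∷ (x , y′) ∷ []) (inj₂ (refl , s) ∷ [-]) _ =
  record { line = vertical , x ; walk = y ∷ y′ ∷ [] ; unit = s ∷ [-] ; traced = refl }
straighten (p ∷ q ∷ r ∷ ps) (e ∷ l) noBend
  with straighten (q ∷ r ∷ ps) l (λ (a , b , c , i , bend) → noBend (a , b , c , there i , bend))
... | record { line = horizontal , y ; walk = i ∷ k ∷ is ; unit = s ∷ ss ; traced = refl } with e
...   | inj₁ (t , refl) =
  record { line = horizontal , y ; walk = _ ∷ i ∷ k ∷ is ; unit = t ∷ s ∷ ss ; traced = refl }
...   | inj₂ v = contradiction (_ , _ , _ , here (refl ∷ refl ∷ refl ∷ []) , inj₂ (v , s , refl)) noBend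
straighten (p ∷ q ∷ r ∷ ps) (e ∷ l) noBend
    | record { line = vertical , x ; walk = i ∷ k ∷ is ; unit = s ∷ ss ; traced = refl } with e
...   | inj₂ (refl , t) =
  record { line = vertical , x ; walk = _ ∷ i ∷ k ∷ is ; unit = t ∷ s ∷ ss ; traced = refl }
...   | inj₁ h = contradiction (_ , _ , _ , here (refl ∷ refl ∷ refl ∷ []) , inj₁ (h , refl , s)) noBend

-- S₃ is not in B₀

-- `U` bridges `u` to `u′`, `X` bridges `u′` to `w′`, `W` bridges `w′` to `w`: chained, they leave
-- no hole between `u` and `w`.
convex-cover : ∀ {X U W : ℤ → Set} → Convex X → Convex U → Convex W → ∀ {u u′ w w′ m} →
  U u → U u′ → W w → W w′ → X u′ → X w′ → u ≤ᶻ m → m ≤ᶻ w → X m ⊎ U m ⊎ W m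
convex-cover cX cU cW {u} {u′} {w} {w′} {m} Uu Uu′ Ww Ww′ Xu′ Xw′ u≤m m≤w with ℤ.≤-total m u′
... | inj₁ m≤u′ = inj₂ (inj₁ (cU Uu Uu′ u≤m m≤u′))
... | inj₂ u′≤m with ℤ.≤-total m w′
...   | inj₁ m≤w′ = inj₁ (cX Xu′ Xw′ u′≤m m≤w′)
...   | inj₂ w′≤m = inj₂ (inj₂ (cW Ww′ Ww w′≤m m≤w))

module _ {n : ℕ} {G : Graph n} where
  open Graph G

  B₀⇒S₃-free : B₀ G → ¬ (S₃ IsInducedIn G)
  B₀⇒S₃-free (R , bendless) (f , f-injective , iso) = asteroidal
    where
    open EPGRepresentation R

    straight : ∀ v → Straight (path v)
    straight v = straighten _ (GridPath.linked (path v)) (bendless v)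

    On : Fin 6 → ℤ → Set
    On u = Covers (straight (f u))

    convex : ∀ u → Convex (On u)
    convex u = covers-convex (straight (f u))

    lineOf : Fin 6 → Line
    lineOf u = line (straight (f u))

    meet : ∀ u v {_ : True (Graph._~?_ S₃ u v)} → lineOf u ≡ lineOf v × ∃[ j ] (On u j × On v j)
    meet u v {uv} = share⁻ (straight (f u)) (straight (f v))
      (Equivalence.to (adjacent (f u) (f v) fu≢fv) fu~fv)
      where
      fu~fv : f u ~ f v
      fu~fv = Equivalence.to (iso u v) (toWitness uv)
      fu≢fv : f u ≢ f v
      fu≢fv eq = ~-irr (f v) (subst (_~ f v) eq fu~fv)

    apart : ∀ u v {_ : False (Graph._~?_ S₃ u v)} → u ≢ v → lineOf u ≡ lineOf v → ∀ {j} → On u j → On v j → ⊥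
    apart u v {uv} u≢v ℓ≡ ju jv = toWitnessFalse uv (Equivalence.from (iso u v)
      (Equivalence.from (adjacent (f u) (f v) (u≢v ∘ f-injective)) (share⁺ (straight (f u)) (straight (f v)) ℓ≡ ju jv)))

    x₁ x₂ x₃ y₁ y₂ y₃ : Fin 6
    x₁ = # 0
    x₂ = # 1
    x₃ = # 2
    y₁ = # 3
    y₂ = # 4
    y₃ = # 5

    -- The path v of an edge m lying between edges of u and w would have to meet
    -- u, w or any path x meeting both of them.
    not-between : ∀ x u v w {_ : False (Graph._~?_ S₃ x v)} {_ : False (Graph._~?_ S₃ u v)}
      {_ : False (Graph._~?_ S₃ w v)} → x ≢ v → u ≢ v → w ≢ v →
      lineOf x ≡ lineOf v → lineOf u ≡ lineOf v → lineOf w ≡ lineOf v → ∀ {i i′ k k′ m} →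
      On u i → On u i′ → On w k → On w k′ → On x i′ → On x k′ → On v m → i ≤ᶻ m → m ≤ᶻ k → ⊥
    not-between x u v w {xv} {uv} {wv} x≢v u≢v w≢v ℓx ℓu ℓw ui ui′ wk wk′ xi′ xk′ vm i≤m m≤k
      with convex-cover (convex x) (convex u) (convex w) ui ui′ wk wk′ xi′ xk′ i≤m m≤k
    ... | inj₁ xm        = apart x v {xv} x≢v ℓx xm vm
    ... | inj₂ (inj₁ um) = apart u v {uv} u≢v ℓu um vm
    ... | inj₂ (inj₂ wm) = apart w v {wv} w≢v ℓw wm vm

    asteroidal : ⊥
    asteroidal
      with x₁y₁ , a , x₁a , y₁a ← meet x₁ y₁ | x₂y₁ , b , x₂b , y₁b ← meet x₂ y₁
         | x₂y₂ , c , x₂c , y₂c ← meet x₂ y₂ | x₃y₂ , d , x₃d , y₂d ← meet x₃ y₂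
         | x₃y₃ , e , x₃e , y₃e ← meet x₃ y₃ | x₁y₃ , g , x₁g , y₃g ← meet x₁ y₃
      = order (ℤ.≤-total a c) (ℤ.≤-total c e) (ℤ.≤-total a e)
      where
      -- A shared edge forces a common line, so the paths of `y₁`, `x₂`, `y₂`, `x₃`, `y₃` all lie on
      -- one.
      y₁y₂ : lineOf y₁ ≡ lineOf y₂
      y₁y₂ = trans (sym x₂y₁) x₂y₂
      y₂y₃ : lineOf y₂ ≡ lineOf y₃
      y₂y₃ = trans (sym x₃y₂) x₃y₃
      y₁y₃ : lineOf y₁ ≡ lineOf y₃
      y₁y₃ = trans y₁y₂ y₂y₃

      -- The edges `a`, `c`, `e` belong to `y₁`, `y₂`, `y₃`. Their median names the middle path, and
      -- the `x` chosen is the one adjacent to the two outer paths and not to the middle one.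
      order : a ≤ᶻ c ⊎ c ≤ᶻ a → c ≤ᶻ e ⊎ e ≤ᶻ c → a ≤ᶻ e ⊎ e ≤ᶻ a → ⊥
      order (inj₁ a≤c) (inj₁ c≤e) _ = not-between x₁ y₁ y₂ y₃ (λ ()) (λ ()) (λ ())
        (trans x₁y₁ y₁y₂) y₁y₂ (sym y₂y₃) y₁a y₁a y₃e y₃g x₁a x₁g y₂c a≤c c≤e
      order (inj₂ c≤a) (inj₂ e≤c) _ = not-between x₁ y₃ y₂ y₁ (λ ()) (λ ()) (λ ())
        (trans x₁y₁ y₁y₂) (sym y₂y₃) y₁y₂ y₃e y₃g y₁a y₁a x₁g x₁a y₂c e≤c c≤a
      order (inj₁ _) (inj₂ e≤c) (inj₁ a≤e) = not-between x₂ y₁ y₃ y₂ (λ ()) (λ ()) (λ ())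
        (trans x₂y₂ y₂y₃) y₁y₃ y₂y₃ y₁a y₁b y₂c y₂c x₂b x₂c y₃e a≤e e≤c
      order (inj₂ _) (inj₁ c≤e) (inj₂ e≤a) = not-between x₂ y₂ y₃ y₁ (λ ()) (λ ()) (λ ())
        (trans x₂y₂ y₂y₃) y₂y₃ y₁y₃ y₂c y₂c y₁a y₁b x₂c x₂b y₃e c≤e e≤a
      order (inj₁ a≤c) (inj₂ _) (inj₂ e≤a) = not-between x₃ y₃ y₁ y₂ (λ ()) (λ ()) (λ ())
        (trans x₃y₃ (sym y₁y₃)) (sym y₁y₃) (sym y₁y₂) y₃e y₃e y₂c y₂d x₃e x₃d y₁a e≤a a≤c
      order (inj₂ c≤a) (inj₁ _) (inj₁ a≤e) = not-between x₃ y₂ y₁ y₃ (λ ()) (λ ()) (λ ())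
        (trans x₃y₃ (sym y₁y₃)) (sym y₁y₂) (sym y₁y₃) y₂c y₂d y₃e y₃e x₃d x₃e y₁a c≤a a≤e

-- Interval graphs are in B₀

climb : ℤ → ℕ → List ℤ
climb x zero    = []
climb x (suc k) = sucℤ x ∷ climb (sucℤ x) k

climb-linked : ∀ x k → Linked UnitStep (x ∷ climb x k)
climb-linked x zero    = [-]
climb-linked x (suc k) = inj₁ refl ∷ climb-linked (sucℤ x) k

+[1+k]+i≡+k+suc[i] : ∀ k i → + suc k +ᶻ i ≡ + k +ᶻ sucℤ i
+[1+k]+i≡+k+suc[i] k i = begin
  + suc k +ᶻ i        ≡⟨ cong (λ m → + m +ᶻ i) (ℕ.+-comm 1 k) ⟩
  (+ k +ᶻ + 1) +ᶻ i   ≡⟨ ℤ.+-assoc (+ k) (+ 1) i ⟩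
  + k +ᶻ sucℤ i       ∎
  where open ≡-Reasoning

climb-top : ∀ x k → + k +ᶻ x ∈ x ∷ climb x k
climb-top x zero    = here (ℤ.+-identityˡ x)
climb-top x (suc k) = there (subst (_∈ climb x (suc k)) (sym (+[1+k]+i≡+k+suc[i] k x)) (climb-top (sucℤ x) k))

climb-bounds : ∀ x k → All (λ i → x ≤ᶻ i × i ≤ᶻ + k +ᶻ x) (x ∷ climb x k)
climb-bounds x zero    = (ℤ.≤-refl , ℤ.≤-reflexive (sym (ℤ.+-identityˡ x))) ∷ []
climb-bounds x (suc k) =
  (ℤ.≤-refl , ℤ.i≤j+i x (+ suc k)) ∷
  All.map (λ (l , u) → ℤ.≤-trans (ℤ.i≤suc[i] x) l , subst (_ ≤ᶻ_) (sym (+[1+k]+i≡+k+suc[i] k x)) u)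
          (climb-bounds (sucℤ x) k)

record IntervalModel {n : ℕ} (G : Graph n) : Set where
  open Graph G
  field
    left right : Fin n → ℤ
    nonEmpty   : ∀ v → left v ≤ᶻ right v
    overlaps   : ∀ u v → u ≢ v → (u ~ v) ⇔ (left u ≤ᶻ right v × left v ≤ᶻ right u)

module _ {n : ℕ} {G : Graph n} (M : IntervalModel G) where
  open IntervalModel M

  -- The interval [l , r] becomes the grid path through (l , 0), …, (r + 1 , 0).
  private
    size : Fin n → ℕ
    size v = ∣ right v - left v ∣

    top : ∀ v → + suc (size v) +ᶻ left v ≡ sucℤ (right v)
    top v = begin
      + suc (size v) +ᶻ left v              ≡⟨ ℤ.suc-+ (size v) (left v) ⟩
      sucℤ (+ size v +ᶻ left v)             ≡⟨ cong (λ i → sucℤ (i +ᶻ left v)) (ℤ.0≤i⇒+∣i∣≡i (ℤ.i≤j⇒0≤j-i (nonEmpty v))) ⟩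
      sucℤ ((right v - left v) +ᶻ left v)   ≡⟨ cong sucℤ (ℤ.+-assoc (right v) _ (left v)) ⟩
      sucℤ (right v +ᶻ _)                   ≡⟨ cong (λ i → sucℤ (right v +ᶻ i)) (ℤ.+-inverseˡ (left v)) ⟩
      sucℤ (right v +ᶻ 0ℤ)                  ≡⟨ cong sucℤ (ℤ.+-identityʳ (right v)) ⟩
      sucℤ (right v)                        ∎
      where open ≡-Reasoning

    axis₀ : Line
    axis₀ = horizontal , 0ℤ

    segment : Fin n → GridPath
    segment v = record
      -- Position `j` becomes the grid edge from `j` to `j + 1`, hence one step more than `size v`;
      -- a one-point interval still has an edge to share.
      { points = pointOn axis₀ (left v) ∷ map (pointOn axis₀) (climb (left v) (suc (size v)))
      ; linked = Linked.map⁺ (Linked.map (λ s → inj₁ (s , refl)) (climb-linked (left v) (suc (size v))))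
      }

    segment-straight : ∀ v → Straight (segment v)
    segment-straight v = record
      { line = axis₀ ; walk = _ ; unit = climb-linked (left v) (suc (size v)) ; traced = refl }

    covers⁺ : ∀ v {j} → left v ≤ᶻ j → j ≤ᶻ right v → Covers (segment-straight v) j
    covers⁺ v l≤j j≤r = traverses-between (climb-linked (left v) (suc (size v)))
      (here refl) (climb-top (left v) (suc (size v))) l≤j
      (subst (_ <ᶻ_) (sym (top v)) (i≤j⇒i<suc[j] j≤r))

    covers⁻ : ∀ v {j} → Covers (segment-straight v) j → left v ≤ᶻ j × j ≤ᶻ right v
    covers⁻ v {j} c with j∈ , 1+j∈ ← traverses-∈ c =
      proj₁ (All.lookup bounds j∈) ,
      i<suc[j]⇒i≤j (ℤ.suc[i]≤j⇒i<j (subst (sucℤ j ≤ᶻ_) (top v) (proj₂ (All.lookup bounds 1+j∈))))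
      where bounds = climb-bounds (left v) (suc (size v))

    share-iff-overlap : ∀ u v → ShareEdge (segment u) (segment v) ⇔ (left u ≤ᶻ right v × left v ≤ᶻ right u)
    share-iff-overlap u v = mk⇔ to from
      where
      to : ShareEdge (segment u) (segment v) → left u ≤ᶻ right v × left v ≤ᶻ right u
      to sh with _ , j , cu , cv ← share⁻ (segment-straight u) (segment-straight v) sh
            with lu , ru ← covers⁻ u cu | lv , rv ← covers⁻ v cv = ℤ.≤-trans lu rv , ℤ.≤-trans lv ru
      from : left u ≤ᶻ right v × left v ≤ᶻ right u → ShareEdge (segment u) (segment v)
      -- The larger of the two left ends lies in both intervals.
      from (lu≤rv , lv≤ru) with ℤ.≤-total (left u) (left v)
      ... | inj₁ lu≤lv = share⁺ (segment-straight u) (segment-straight v) refl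
                           (covers⁺ u lu≤lv lv≤ru) (covers⁺ v ℤ.≤-refl (nonEmpty v))
      ... | inj₂ lv≤lu = share⁺ (segment-straight u) (segment-straight v) refl
                           (covers⁺ u ℤ.≤-refl (nonEmpty u)) (covers⁺ v lv≤lu lu≤rv)

    vertical-free : ∀ v {p q r} → Occurs (p ∷ q ∷ r ∷ []) (segment v) → ¬ Vertical p q × ¬ Vertical q r
    vertical-free v = go _
      where
      go : ∀ is {p q r} → Infix _≡_ (p ∷ q ∷ r ∷ []) (map (pointOn axis₀) is) → ¬ Vertical p q × ¬ Vertical q r
      go (_ ∷ _ ∷ _ ∷ _) (here (refl ∷ refl ∷ refl ∷ [])) =
        (λ (_ , s) → unitStep-irrefl s) , (λ (_ , s) → unitStep-irrefl s)
      go []           (here ())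
      go (_ ∷ [])     (here (_ ∷ ()))
      go (_ ∷ _ ∷ []) (here (_ ∷ _ ∷ ()))
      go (_ ∷ is) (there i) = go is i

  intervals⇒B₀ : B₀ G
  intervals⇒B₀ =
    record { path = segment ; adjacent = λ u v u≢v → ⇔-sym (share-iff-overlap u v) ⇔-∘ overlaps u v u≢v } ,
    λ { v (_ , _ , _ , o , inj₁ (_ , qr)) → proj₂ (vertical-free v o) qr
      ; v (_ , _ , _ , o , inj₂ (pq , _)) → proj₁ (vertical-free v o) pq }

-- Extremal vertices for a decidable property

module _ {n : ℕ} (f : Fin n → ℕ) {P : Fin n → Set} (P? : Decidable P) {w : Fin n} (Pw : P w) where

  minimum : ∃[ m ] (P m × (∀ v → P v → f m ≤ f v))
  minimum = argmin f w ps , argmin-all f Pw (all-filter P? (allFin n)) ,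
    λ v Pv → All.lookup (f[argmin]≤f[xs] {f = f} w ps) (∈-filter⁺ P? (∈-allFin v) Pv)
    where ps = filter P? (allFin n)

  maximum : ∃[ m ] (P m × (∀ v → P v → f v ≤ f m))
  maximum = argmax f w ps , argmax-all f Pw (all-filter P? (allFin n)) ,
    λ v Pv → All.lookup (f[xs]≤f[argmax] {f = f} w ps) (∈-filter⁺ P? (∈-allFin v) Pv)
    where ps = filter P? (allFin n)

-- Recognising S₃

-- The six pairs left over by the nine edges: the `yᵢ` among themselves, and each `yᵢ` with the `xⱼ`
-- that it misses.
S₃-nonEdges : List (Fin 6 × Fin 6)
S₃-nonEdges = (# 3 , # 4) ∷ (# 3 , # 5) ∷ (# 4 , # 5)
            ∷ (# 0 , # 4) ∷ (# 1 , # 5) ∷ (# 2 , # 3) ∷ []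

abstract
  -- A finite check, settled by evaluation; `abstract` keeps that evaluation from unfolding in the
  -- case splits below.
  S₃-pairs : ∀ u v → u ≡ v ⊎ Graph._~_ S₃ u v ⊎ (u , v) ∈ S₃-nonEdges ⊎ (v , u) ∈ S₃-nonEdges
  S₃-pairs = toWitness {a? = all? λ u → all? λ v →
    (u ≟ v) ⊎-dec (Graph._~?_ S₃ u v) ⊎-dec ((u , v) ∈? S₃-nonEdges) ⊎-dec ((v , u) ∈? S₃-nonEdges)} _
    where open DecMembership (≡-dec (_≟_ {6}) (_≟_ {6})) using (_∈?_)

module _ {n : ℕ} (G : Graph n) where
  open Graph G

  -- The ends of an edge have distinct images because `G` has no loops. Non-edges give no such
  -- guarantee, so their list carries `≢` as well.
  S₃-induced : (f : Fin 6 → Fin n) → All (λ (u , v) → f u ~ f v) S₃-edges →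
               All (λ (u , v) → f u ≢ f v × ¬ (f u ~ f v)) S₃-nonEdges → S₃ IsInducedIn G
  S₃-induced f edges nonEdges = f , injective , λ u v → mk⇔ preserves (reflects u v)
    where
    preserves : ∀ {u v} → Graph._~_ S₃ u v → f u ~ f v
    preserves = [ All.lookup edges , ~-sym ∘ All.lookup edges ]

    injective : ∀ {u v} → f u ≡ f v → u ≡ v
    injective {u} {v} eq with S₃-pairs u v
    ... | inj₁ u≡v                = u≡v
    ... | inj₂ (inj₁ uv)          = contradiction (subst (f u ~_) (sym eq) (preserves uv)) (~-irr (f u))
    ... | inj₂ (inj₂ (inj₁ uv∈)) = contradiction eq (proj₁ (All.lookup nonEdges uv∈))
    ... | inj₂ (inj₂ (inj₂ vu∈)) = contradiction (sym eq) (proj₁ (All.lookup nonEdges vu∈))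

    reflects : ∀ u v → f u ~ f v → Graph._~_ S₃ u v
    reflects u v e with S₃-pairs u v
    ... | inj₁ refl               = contradiction e (~-irr (f u))
    ... | inj₂ (inj₁ uv)          = uv
    ... | inj₂ (inj₂ (inj₁ uv∈)) = contradiction e (proj₂ (All.lookup nonEdges uv∈))
    ... | inj₂ (inj₂ (inj₂ vu∈)) = contradiction (~-sym e) (proj₂ (All.lookup nonEdges vu∈))

  -- Interval models of parts of the graph, and how to extend and glue them

  record Layout (A : Fin n → Set) : Set where
    field
      -- Positions are natural numbers so that there is a first one, 0, at which the layout can be
      -- extended. The functions are total, but adjacency is tied to them on `A` only.
      lo hi    : Fin n → ℕ
      lo≤hi    : ∀ v → lo v ≤ hi v
      overlaps : ∀ {u v} → A u → A v → u ≢ v → (u ~ v) ⇔ (lo u ≤ hi v × lo v ≤ hi u)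

  open Layout

  -- The leftmost end is where further vertices can be attached.
  AtEnd : ∀ {A} → Layout A → Fin n → Set
  AtEnd L v = lo L v ≡ 0

  clique : ∀ {A} → (∀ {u v} → A u → A v → u ≢ v → u ~ v) → Layout A
  clique complete = record
    { lo = λ _ → 0 ; hi = λ _ → 0 ; lo≤hi = λ _ → z≤n
    ; overlaps = λ Au Av u≢v → mk⇔ (λ _ → z≤n , z≤n) (λ _ → complete Au Av u≢v) }

  complete-intervals : (∀ {u v} → u ≢ v → u ~ v) → IntervalModel G
  complete-intervals complete = record
    { left = λ _ → + 0 ; right = λ _ → + 0 ; nonEmpty = λ _ → +≤+ z≤n
    ; overlaps = λ _ _ u≢v → mk⇔ (λ _ → +≤+ z≤n , +≤+ z≤n) (λ _ → complete u≢v) }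

  -- A new position is put in front. `x` lives on it alone, `c` and `d` stretch from it over their
  -- old intervals, and everything else moves up by one; so exactly `c` and `d` meet `x`.
  module _ {A B : Fin n → Set} (x c d : Fin n) (L : Layout A)
           (c-end : AtEnd L c) (d-end : AtEnd L d)
           (B⊆ : ∀ {v} → B v → v ≢ x → A v)
           (x~c : x ~ c) (x~d : x ~ d) (x~only : ∀ {v} → A v → x ~ v → v ≡ c ⊎ v ≡ d) where

    private
      Front : Fin n → Set
      Front v = v ≡ x ⊎ v ≡ c ⊎ v ≡ d

      front? : ∀ v → Dec (Front v)
      front? v = (v ≟ x) ⊎-dec (v ≟ c) ⊎-dec (v ≟ d)

      lo′ hi′ : Fin n → ℕ
      lo′ v with front? v
      ... | yes _ = 0
      ... | no  _ = suc (lo L v)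
      hi′ v with v ≟ x
      ... | yes _ = 0
      ... | no  _ = suc (hi L v)

      lo′-front : ∀ {v} → Front v → lo′ v ≡ 0
      lo′-front {v} f with front? v
      ... | yes _ = refl
      ... | no ¬f = contradiction f ¬f

      lo′-zero : ∀ {v} → lo′ v ≤ 0 → Front v
      lo′-zero {v} le with front? v | le
      ... | yes f | _ = f
      ... | no  _ | ()

      hi′-other : ∀ {v} → v ≢ x → hi′ v ≡ suc (hi L v)
      hi′-other {v} v≢x with v ≟ x
      ... | yes v≡x = contradiction v≡x v≢x
      ... | no _    = refl

      hi′-x : hi′ x ≡ 0
      hi′-x with x ≟ x
      ... | yes _ = refl
      ... | no x≢x = contradiction refl x≢x

      lo′≤hi′ : ∀ v → lo′ v ≤ hi′ v
      lo′≤hi′ v with front? v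
      ... | yes _ = z≤n
      ... | no ¬f with v ≟ x
      ...   | yes v≡x = contradiction (inj₁ v≡x) ¬f
      ...   | no _    = s≤s (lo≤hi L v)

      shift : ∀ {u v} → u ≢ x → v ≢ x → (lo L u ≤ hi L v) ⇔ (lo′ u ≤ hi′ v)
      shift {u} {v} u≢x v≢x rewrite hi′-other v≢x with front? u
      ... | yes (inj₁ u≡x)         = contradiction u≡x u≢x
      -- Both comparisons hold outright, since `c` and `d` start at 0 in the old layout and in the
      -- new one.
      ... | yes (inj₂ (inj₁ refl)) = mk⇔ (λ _ → z≤n) (λ _ → subst (_≤ hi L v) (sym c-end) z≤n)
      ... | yes (inj₂ (inj₂ refl)) = mk⇔ (λ _ → z≤n) (λ _ → subst (_≤ hi L v) (sym d-end) z≤n)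
      ... | no _                   = mk⇔ s≤s s≤s⁻¹

      x-overlaps : ∀ {v} → A v → v ≢ x → (x ~ v) ⇔ (lo′ x ≤ hi′ v × lo′ v ≤ hi′ x)
      x-overlaps {v} Av v≢x = mk⇔
        (λ e → subst (_≤ hi′ v) (sym (lo′-front (inj₁ refl))) z≤n ,
               subst (_≤ hi′ x) (sym (lo′-front (inj₂ (x~only Av e)))) z≤n)
        (λ (_ , le) → adjacent (lo′-zero (subst (lo′ v ≤_) hi′-x le)))
        where
        adjacent : Front v → x ~ v
        adjacent (inj₁ v≡x)         = contradiction v≡x v≢x
        adjacent (inj₂ (inj₁ refl)) = x~c
        adjacent (inj₂ (inj₂ refl)) = x~d

      overlaps′ : ∀ {u v} → B u → B v → u ≢ v → (u ~ v) ⇔ (lo′ u ≤ hi′ v × lo′ v ≤ hi′ u)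
      overlaps′ {u} {v} Bu Bv u≢v = go (u ≟ x) (v ≟ x)
        where
        go : Dec (u ≡ x) → Dec (v ≡ x) → (u ~ v) ⇔ (lo′ u ≤ hi′ v × lo′ v ≤ hi′ u)
        go (yes u≡x)  (yes v≡x)  = contradiction (trans u≡x (sym v≡x)) u≢v
        go (yes refl) (no v≢x)   = x-overlaps (B⊆ Bv v≢x) v≢x
        go (no u≢x)   (yes refl) =
          mk⇔ ×-swap ×-swap ⇔-∘ (x-overlaps (B⊆ Bu u≢x) u≢x ⇔-∘ mk⇔ ~-sym ~-sym)
        go (no u≢x)   (no v≢x)   =
          (shift u≢x v≢x ×-⇔ shift v≢x u≢x) ⇔-∘ overlaps L (B⊆ Bu u≢x) (B⊆ Bv v≢x) u≢v

    attach : Layout B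
    attach = record { lo = lo′ ; hi = hi′ ; lo≤hi = lo′≤hi′ ; overlaps = overlaps′ }

    attach-end : ∀ {v} → v ≡ x ⊎ v ≡ c ⊎ v ≡ d → AtEnd attach v
    attach-end = lo′-front

  -- `M` is reflected by sending `k` to `-[1+ k ]` and placed to the left of `L`. A vertex of both
  -- parts starts at 0 in both, so its interval runs across the seam between -1 and 0; the others
  -- stay on their side, and `separated` ensures that no edge has to bridge the seam between two of
  -- them.
  module _ {A B : Fin n → Set} (A? : Decidable A) (B? : Decidable B) (L : Layout A) (M : Layout B)
           (cover : ∀ v → A v ⊎ B v)
           (common-end : ∀ {v} → A v → B v → AtEnd L v × AtEnd M v)
           (separated : ∀ {u v} → A u → B v → u ~ v → B u ⊎ A v) where

    private
      left right : Fin n → ℤ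
      left v with B? v
      ... | yes _ = -[1+ hi M v ]
      ... | no  _ = + lo L v
      right v with A? v
      ... | yes _ = + hi L v
      ... | no  _ = -[1+ lo M v ]

      left≤right : ∀ v → left v ≤ᶻ right v
      left≤right v with A? v | B? v | cover v
      ... | yes _ | yes _ | _       = -≤+
      ... | yes _ | no _  | _       = +≤+ (lo≤hi L v)
      ... | no _  | yes _ | _       = -≤- (lo≤hi M v)
      ... | no ¬a | no _  | inj₁ a = contradiction a ¬a
      ... | no _  | no ¬b | inj₂ b = contradiction b ¬b

      compare-A : ∀ {u v} → A u → A v → (lo L u ≤ hi L v) ⇔ (left u ≤ᶻ right v)
      compare-A {u} {v} Au Av with B? u | A? v
      ... | _      | no ¬Av = contradiction Av ¬Av
      ... | yes Bu | yes _  = mk⇔ (λ _ → -≤+) (λ _ → subst (_≤ hi L v) (sym (proj₁ (common-end Au Bu))) z≤n)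
      ... | no _   | yes _  = mk⇔ +≤+ (λ { (+≤+ le) → le })

      -- Reflection exchanges left and right ends, so `u` and `v` trade places.
      compare-B : ∀ {u v} → B u → B v → (lo M v ≤ hi M u) ⇔ (left u ≤ᶻ right v)
      compare-B {u} {v} Bu Bv with B? u | A? v
      ... | no ¬Bu | _      = contradiction Bu ¬Bu
      ... | yes _  | yes Av = mk⇔ (λ _ → -≤+) (λ _ → subst (_≤ hi M u) (sym (proj₂ (common-end Av Bv))) z≤n)
      ... | yes _  | no _   = mk⇔ -≤- (λ { (-≤- le) → le })

      disjoint : ∀ {u v} → ¬ B u → ¬ A v → ¬ (left u ≤ᶻ right v)
      disjoint {u} {v} ¬Bu ¬Av le with B? u | A? v | le
      ... | yes Bu | _      | _ = ¬Bu Bu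
      ... | no _   | yes Av | _ = ¬Av Av
      ... | no _   | no _   | ()

      overlaps″ : ∀ u v → u ≢ v → (u ~ v) ⇔ (left u ≤ᶻ right v × left v ≤ᶻ right u)
      overlaps″ u v u≢v = go (A? u) (B? u) (A? v) (B? v)
        where
        go : Dec (A u) → Dec (B u) → Dec (A v) → Dec (B v) →
             (u ~ v) ⇔ (left u ≤ᶻ right v × left v ≤ᶻ right u)
        go (yes Au) _        (yes Av) _        =
          (compare-A Au Av ×-⇔ compare-A Av Au) ⇔-∘ overlaps L Au Av u≢v
        go _        (yes Bu) _        (yes Bv) =
          (compare-B Bu Bv ×-⇔ compare-B Bv Bu) ⇔-∘ (mk⇔ ×-swap ×-swap ⇔-∘ overlaps M Bu Bv u≢v)
        go (yes Au) (no ¬Bu) (no ¬Av) (yes Bv) = mk⇔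
          (λ e → contradiction (separated Au Bv e) [ ¬Bu , ¬Av ])
          (λ (p , _) → contradiction p (disjoint ¬Bu ¬Av))
        go (no ¬Au) (yes Bu) (yes Av) (no ¬Bv) = mk⇔
          (λ e → contradiction (separated Av Bu (~-sym e)) [ ¬Bv , ¬Au ])
          (λ (_ , q) → contradiction q (disjoint ¬Bv ¬Au))
        go (no ¬Au) (no ¬Bu) _        _        = contradiction (cover u) [ ¬Au , ¬Bu ]
        go _        _        (no ¬Av) (no ¬Bv) = contradiction (cover v) [ ¬Av , ¬Bv ]

    glue : IntervalModel G
    glue = record { left = left ; right = right ; nonEmpty = left≤right ; overlaps = overlaps″ }

-- Triangulated polygons

module Triangulation {n : ℕ} (G : Graph n) (π : Permutation′ n) (nonCrossing : NonCrossing G π)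
  (maximal : ∀ u v (u≢v : u ≢ v) → ¬ (Graph._~_ G u v) → ¬ Outerplanar (addEdge G u v u≢v)) where
  open Graph G

  pos : Fin n → ℕ
  pos v = toℕ (π ⟨$⟩ʳ v)

  pos-injective : ∀ {u v} → pos u ≡ pos v → u ≡ v
  pos-injective = Injection.injective (↔⇒↣ π) ∘ toℕ-injective

  infix 4 _≺_ _≺?_ _≼_

  _≺_ _≼_ : Fin n → Fin n → Set
  u ≺ v = pos u < pos v
  u ≼ v = pos u ≤ pos v

  _≺?_ : ∀ u v → Dec (u ≺ v)
  u ≺? v = pos u <? pos v

  ≺⇒≢ : ∀ {u v} → u ≺ v → u ≢ v
  ≺⇒≢ u≺v refl = ℕ.<-irrefl refl u≺v

  ≼⇒≡⊎≺ : ∀ {u v} → u ≼ v → u ≡ v ⊎ u ≺ v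
  ≼⇒≡⊎≺ = swap ∘ Sum.map₂ pos-injective ∘ ℕ.m≤n⇒m<n∨m≡n

  Between : Fin n → Fin n → Fin n → Set
  Between a b v = a ≺ v × v ≺ b

  between? : ∀ a b → Decidable (Between a b)
  between? a b v = (a ≺? v) ×-dec (v ≺? b)

  Within : Fin n → Fin n → Fin n → Set
  Within a b v = a ≼ v × v ≼ b

  within? : ∀ a b → Decidable (Within a b)
  within? a b v = (pos a ≤? pos v) ×-dec (pos v ≤? pos b)

  Outside : Fin n → Fin n → Fin n → Set
  Outside a b v = v ≺ a ⊎ b ≺ v

  Gap : Fin n → Fin n → Set
  Gap a b = ¬ (∃[ v ] Between a b v)

  inhabited? : ∀ a b → Dec (∃[ v ] Between a b v)
  inhabited? a b = any? (between? a b)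

  chord-separates : ∀ {a b u v} → a ~ b → Between a b u → Outside a b v → ¬ (u ~ v)
  chord-separates a~b (a≺u , u≺b) (inj₁ v≺a) u~v = nonCrossing (~-sym u~v) a~b (v≺a , a≺u , u≺b)
  chord-separates a~b (a≺u , u≺b) (inj₂ b≺v) u~v = nonCrossing a~b u~v (a≺u , u≺b , b≺v)

  -- Otherwise the chord uv could be added to the drawing.
  crossed : ∀ {u v} → u ≺ v → ¬ (u ~ v) → ∃[ x ] ∃[ y ] (x ~ y × Between u v x × Outside u v y)
  crossed {u} {v} u≺v u≁v
    with any? (λ x → any? λ y → (x ~? y) ×-dec between? u v x ×-dec ((y ≺? u) ⊎-dec (v ≺? y)))
  ... | yes found = found
  ... | no ¬found = contradiction (π , λ {a} {b} {c} {d} → still {a} {b} {c} {d}) (maximal u v (≺⇒≢ u≺v) u≁v)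
    where
    still : NonCrossing (addEdge G u v (≺⇒≢ u≺v)) π
    still (inj₁ ab) (inj₁ cd) crossing = nonCrossing ab cd crossing
    still (inj₁ ab) (inj₂ (inj₁ (refl , refl))) (a≺c , c≺b , b≺d) =
      ¬found (_ , _ , ~-sym ab , (c≺b , b≺d) , inj₁ a≺c)
    still (inj₁ ab) (inj₂ (inj₂ (refl , refl))) (a≺c , c≺b , b≺d) = ℕ.<-asym u≺v (ℕ.<-trans c≺b b≺d)
    still (inj₂ (inj₁ (refl , refl))) (inj₁ cd) (a≺c , c≺b , b≺d) =
      ¬found (_ , _ , cd , (a≺c , c≺b) , inj₂ b≺d)
    still (inj₂ (inj₂ (refl , refl))) _ (a≺c , c≺b , _) = ℕ.<-asym u≺v (ℕ.<-trans a≺c c≺b)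
    still (inj₂ (inj₁ (refl , refl))) (inj₂ (inj₁ (refl , refl))) (a≺c , _) = ℕ.<-irrefl refl a≺c
    still (inj₂ (inj₁ (refl , refl))) (inj₂ (inj₂ (refl , refl))) (_ , c≺b , _) = ℕ.<-irrefl refl c≺b

  -- An edge crossing this chord would need an end strictly between `a` and `b`. Consecutive
  -- vertices are thus joined by the sides of the polygon.
  gap⇒adjacent : ∀ {a b} → a ≺ b → Gap a b → a ~ b
  gap⇒adjacent {a} {b} a≺b gap = decidable-stable (a ~? b) λ a≁b →
    let x , _ , _ , between , _ = crossed a≺b a≁b in gap (x , between)

  -- This is the side that closes the polygon across the cut of the circle: a crossing edge would
  -- need an end outside.
  extremes⇒adjacent : ∀ {a b} → a ≺ b → (∀ v → a ≼ v) → (∀ v → v ≼ b) → a ~ b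
  extremes⇒adjacent {a} {b} a≺b a≼ ≼b = decidable-stable (a ~? b) λ a≁b →
    let _ , y , _ , _ , outside = crossed a≺b a≁b in
    [ ℕ.≤⇒≯ (a≼ y) , ℕ.≤⇒≯ (≼b y) ] outside

  gap-clique : ∀ {a b} → a ~ b → Gap a b → ∀ {u v} → Within a b u → Within a b v → u ≢ v → u ~ v
  gap-clique {a} {b} a~b gap {u} {v} (a≼u , u≼b) (a≼v , v≼b) u≢v
    with ≼⇒≡⊎≺ a≼u | ≼⇒≡⊎≺ u≼b | ≼⇒≡⊎≺ a≼v | ≼⇒≡⊎≺ v≼b
  ... | inj₂ a≺u  | inj₂ u≺b  | _         | _         = contradiction (u , a≺u , u≺b) gap
  ... | _         | _         | inj₂ a≺v  | inj₂ v≺b  = contradiction (v , a≺v , v≺b) gap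
  ... | inj₁ refl | _         | inj₁ refl | _         = contradiction refl u≢v
  ... | _         | inj₁ refl | _         | inj₁ refl = contradiction refl u≢v
  ... | inj₁ refl | _         | _         | inj₁ refl = a~b
  ... | _         | inj₁ refl | inj₁ refl | _         = ~-sym a~b

  -- The apex is the last neighbour c of a before b: an edge crossing cb would
  -- cross ab or ac, or give a later neighbour of a.
  apex : ∀ {a b} → a ~ b → ∃[ w ] Between a b w → ∃[ c ] (Between a b c × a ~ c × c ~ b)
  apex {a} {b} a~b (w , between)
    -- `m` is the next vertex after `a`, joined to it by a side of the polygon; it shows that there
    -- is a neighbour to choose `c` from.
    with m , (a≺m , m≺b) , m-first ← minimum pos (between? a b) between
    with a~m ← gap⇒adjacent a≺m (λ (v , a≺v , v≺m) → ℕ.≤⇒≯ (m-first v (a≺v , ℕ.<-trans v≺m m≺b)) v≺m)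
    with c , ((a≺c , c≺b) , a~c) , c-last ←
      maximum pos (λ v → between? a b v ×-dec (a ~? v)) ((a≺m , m≺b) , a~m)
    = c , (a≺c , c≺b) , a~c , decidable-stable (c ~? b) c~b
    where
    c~b : ¬ ¬ (c ~ b)
    c~b c≁b with crossed c≺b c≁b
    ... | x , y , x~y , (c≺x , x≺b) , inj₂ b≺y = chord-separates a~b (ℕ.<-trans a≺c c≺x , x≺b) (inj₂ b≺y) x~y
    ... | x , y , x~y , (c≺x , x≺b) , inj₁ y≺c with ℕ.<-cmp (pos y) (pos a)
    ...   | tri< y≺a _ _ = chord-separates a~b (ℕ.<-trans a≺c c≺x , x≺b) (inj₁ y≺a) x~y
    ...   | tri> _ _ a≺y = chord-separates a~c (a≺y , y≺c) (inj₂ c≺x) (~-sym x~y)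
    ...   | tri≈ _ y≡a _ with refl ← pos-injective y≡a =
      ℕ.≤⇒≯ (c-last x ((ℕ.<-trans a≺c c≺x , x≺b) , ~-sym x~y)) c≺x

  -- The piece of the polygon cut off by the chord `a b`. Both ends are kept in front because the
  -- triangle on the other side of the chord will be attached to them.
  Strip : Fin n → Fin n → Set
  Strip a b = Σ (Layout G (Within a b)) λ L → AtEnd G L a × AtEnd G L b

  module _ {a b c : Fin n} (a~b : a ~ b) (between : Between a b c) (a~c : a ~ c) (c~b : c ~ b) where

    private
      a≺c = proj₁ between
      c≺b = proj₂ between

      a~only : ∀ {v} → Within c b v → a ~ v → v ≡ c ⊎ v ≡ b
      a~only (c≼v , v≼b) a~v with ≼⇒≡⊎≺ c≼v | ≼⇒≡⊎≺ v≼b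
      ... | inj₁ c≡v | _        = inj₁ (sym c≡v)
      ... | _        | inj₁ v≡b = inj₂ v≡b
      ... | inj₂ c≺v | inj₂ v≺b = contradiction (~-sym a~v) (chord-separates c~b (c≺v , v≺b) (inj₁ a≺c))

      b~only : ∀ {v} → Within a c v → b ~ v → v ≡ a ⊎ v ≡ c
      b~only (a≼v , v≼c) b~v with ≼⇒≡⊎≺ a≼v | ≼⇒≡⊎≺ v≼c
      ... | inj₁ a≡v | _        = inj₁ (sym a≡v)
      ... | _        | inj₁ v≡c = inj₂ v≡c
      ... | inj₂ a≺v | inj₂ v≺c = contradiction (~-sym b~v) (chord-separates a~c (a≺v , v≺c) (inj₂ c≺b))

    -- When `a c` is a side of the polygon, `a` is the one vertex that the piece over `c b` lacks,
    -- and its neighbours there are the two ends of that chord.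
    attach-a : Gap a c → Strip c b → Strip a b
    attach-a gap (L , c-end , b-end) =
      attach G a c b L c-end b-end inside a~c a~b a~only , at (inj₁ refl) , at (inj₂ (inj₂ refl))
      where
      inside : ∀ {v} → Within a b v → v ≢ a → Within c b v
      inside {v} (a≼v , v≼b) v≢a with ≼⇒≡⊎≺ a≼v
      ... | inj₁ a≡v = contradiction (sym a≡v) v≢a
      ... | inj₂ a≺v = ℕ.≮⇒≥ (λ v≺c → gap (v , a≺v , v≺c)) , v≼b
      at = attach-end G a c b L c-end b-end inside a~c a~b a~only

    attach-b : Gap c b → Strip a c → Strip a b
    attach-b gap (L , a-end , c-end) =
      attach G b a c L a-end c-end inside (~-sym a~b) (~-sym c~b) b~only , at (inj₂ (inj₁ refl)) , at (inj₁ refl)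
      where
      inside : ∀ {v} → Within a b v → v ≢ b → Within a c v
      inside {v} (a≼v , v≼b) v≢b with ≼⇒≡⊎≺ v≼b
      ... | inj₁ v≡b = contradiction v≡b v≢b
      ... | inj₂ v≺b = a≼v , ℕ.≮⇒≥ (λ c≺v → gap (v , c≺v , v≺b))
      at = attach-end G b a c L a-end c-end inside (~-sym a~b) (~-sym c~b) b~only

    -- Attaching `b` to the strip over `a c` puts the triangle `a c b` at its front. The ends of
    -- `c b` are then in front in both layouts and are all that the two have in common.
    join : (∀ v → a ≼ v) → (∀ v → v ≼ b) → Strip a c → Strip c b → IntervalModel G
    join a≼ ≼b (L , a-end , c-end) (M , c-end′ , b-end′) =
      glue G (λ v → (v ≟ b) ⊎-dec within? a c v) (within? c b)
           (attach G b a c L a-end c-end inside (~-sym a~b) (~-sym c~b) b~only) M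
           cover common-end separated
      where
      A : Fin n → Set
      A v = v ≡ b ⊎ Within a c v

      inside : ∀ {v} → A v → v ≢ b → Within a c v
      inside (inj₁ v≡b) v≢b = contradiction v≡b v≢b
      inside (inj₂ w)   _   = w

      at = attach-end G b a c L a-end c-end inside (~-sym a~b) (~-sym c~b) b~only

      cover : ∀ v → A v ⊎ Within c b v
      cover v with ℕ.≤-total (pos v) (pos c)
      ... | inj₁ v≼c = inj₁ (inj₂ (a≼ v , v≼c))
      ... | inj₂ c≼v = inj₂ (c≼v , ≼b v)

      common-end : ∀ {v} → A v → Within c b v → _ × AtEnd G M v
      common-end (inj₁ refl) _ = at (inj₁ refl) , b-end′
      common-end (inj₂ (_ , v≼c)) (c≼v , _) with refl ← pos-injective (ℕ.≤-antisym v≼c c≼v) =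
        at (inj₂ (inj₂ refl)) , c-end′

      separated : ∀ {u v} → A u → Within c b v → u ~ v → Within c b u ⊎ A v
      separated (inj₁ refl) _ _ = inj₁ (ℕ.<⇒≤ c≺b , ℕ.≤-refl)
      separated (inj₂ (a≼u , u≼c)) (c≼v , v≼b) u~v with ≼⇒≡⊎≺ u≼c | ≼⇒≡⊎≺ c≼v | ≼⇒≡⊎≺ v≼b
      ... | inj₁ refl | _         | _         = inj₁ (ℕ.≤-refl , ℕ.<⇒≤ c≺b)
      ... | _         | inj₁ refl | _         = inj₂ (inj₂ (ℕ.<⇒≤ a≺c , ℕ.≤-refl))
      ... | _         | _         | inj₁ refl = inj₂ (inj₁ refl)
      ... | inj₂ u≺c  | inj₂ c≺v  | inj₂ v≺b  =
        contradiction (~-sym u~v) (chord-separates c~b (c≺v , v≺b) (inj₁ u≺c))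

  -- The triangle `a c b` is the centre; the apexes `p` and `q` over its inner sides and `z` beyond
  -- `a b` are the tips. The chord `a b` separates `z` from `c`, `p` and `q`, the chord `a c`
  -- separates `p` from `q` and `b`, and `c b` separates `q` from `a`.
  three-sided⇒S₃ : ∀ {a b c z} → a ~ b → a ~ c → c ~ b → Outside a b z → a ~ z → b ~ z →
                   ∃[ v ] Between a c v → ∃[ v ] Between c b v → S₃ IsInducedIn G
  three-sided⇒S₃ {a} {b} {c} {z} a~b a~c c~b out a~z b~z inhabited inhabited′ =
    let p , (a≺p , p≺c) , a~p , p~c = apex a~c inhabited
        q , (c≺q , q≺b) , c~q , q~b = apex c~b inhabited′
        a≺c = ℕ.<-trans a≺p p≺c
        c≺b = ℕ.<-trans c≺q q≺b
    in S₃-induced G (lookup (a ∷ c ∷ b ∷ p ∷ q ∷ z ∷ []))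
      (a~c ∷ a~b ∷ c~b ∷ a~p ∷ ~-sym p~c ∷ c~q ∷ ~-sym q~b ∷ b~z ∷ a~z ∷ [])
      ( (≺⇒≢ (ℕ.<-trans p≺c c≺q) , chord-separates a~c (a≺p , p≺c) (inj₂ c≺q))
      ∷ apart (a≺p , ℕ.<-trans p≺c c≺b)
      ∷ apart (ℕ.<-trans a≺c c≺q , q≺b)
      ∷ (≺⇒≢ (ℕ.<-trans a≺c c≺q) , chord-separates c~b (c≺q , q≺b) (inj₁ a≺c) ∘ ~-sym)
      ∷ apart (a≺c , c≺b)
      ∷ (≢-sym (≺⇒≢ (ℕ.<-trans p≺c c≺b)) , chord-separates a~c (a≺p , p≺c) (inj₂ c≺b) ∘ ~-sym)
      ∷ [])
    where
    apart : ∀ {v} → Between a b v → v ≢ z × ¬ (v ~ z)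
    apart (a≺v , v≺b) =
      [ (λ z≺a → ≢-sym (≺⇒≢ (ℕ.<-trans z≺a a≺v))) , (λ b≺z → ≺⇒≢ (ℕ.<-trans v≺b b≺z)) ] out ,
      chord-separates a~b (a≺v , v≺b) out

  OneSided : Set
  OneSided = ∀ {a b c z} → a ~ b → a ~ c → c ~ b → Outside a b z → a ~ z → b ~ z → Gap a c ⊎ Gap c b

  S₃-free⇒one-sided : ¬ (S₃ IsInducedIn G) → OneSided
  S₃-free⇒one-sided S₃-free {a} {b} {c} a~b a~c c~b out a~z b~z = go (inhabited? a c) (inhabited? c b)
    where
    go : Dec (∃[ v ] Between a c v) → Dec (∃[ v ] Between c b v) → Gap a c ⊎ Gap c b
    go (no gap) _        = inj₁ gap
    go _        (no gap) = inj₂ gap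
    go (yes ac) (yes cb) = contradiction (three-sided⇒S₃ a~b a~c c~b out a~z b~z ac cb) S₃-free

  -- Assembling the strips

  module _ (one-sided : OneSided) where

    -- `k` bounds the length of the chord and drives the recursion, each step passing to a shorter
    -- chord. The corner left behind, `a` or `b`, serves as the new `z`.
    strip : ∀ k {a b z} → pos b ≤ k + pos a → a ≺ b → a ~ b → Outside a b z → a ~ z → b ~ z → Strip a b
    strip zero b≼a a≺b = contradiction a≺b (ℕ.≤⇒≯ b≼a)
    strip (suc k) {a} {b} b≤1+k+a a≺b a~b out a~z b~z with inhabited? a b
    ... | no gap = clique G (gap-clique a~b gap) , refl , refl
    ... | yes inhabited
      with c , (a≺c , c≺b) , a~c , c~b ← apex a~b inhabited
      with one-sided a~b a~c c~b out a~z b~z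
    ...   | inj₁ gap = attach-a a~b (a≺c , c≺b) a~c c~b gap
      (strip k b≤k+c c≺b c~b (inj₁ a≺c) (~-sym a~c) (~-sym a~b))
      where
      b≤k+c : pos b ≤ k + pos c
      b≤k+c = ℕ.≤-trans (subst (pos b ≤_) (sym (ℕ.+-suc k (pos a))) b≤1+k+a) (ℕ.+-monoʳ-≤ k a≺c)
    ...   | inj₂ gap = attach-b a~b (a≺c , c≺b) a~c c~b gap
      (strip k (s≤s⁻¹ (ℕ.≤-trans c≺b b≤1+k+a)) a≺c a~c (inj₂ c≺b) a~b c~b)

    intervalModel : Fin n → IntervalModel G
    intervalModel w
      with a , _ , a-first ← minimum pos {P = λ _ → ⊤} (λ _ → yes tt) {w} tt
      with b , _ , b-last  ← maximum pos {P = λ _ → ⊤} (λ _ → yes tt) {w} tt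
      with a≼ ← (λ v → a-first v tt) | ≼b ← (λ v → b-last v tt)
      with a ≺? b
    -- First and last position coincide: there is a single vertex.
    ... | no a⊀b = complete-intervals G λ {u} {v} u≢v → contradiction
      (pos-injective (ℕ.≤-antisym (ℕ.≤-trans (≼b u) (ℕ.≤-trans (ℕ.≮⇒≥ a⊀b) (a≼ v)))
                                  (ℕ.≤-trans (≼b v) (ℕ.≤-trans (ℕ.≮⇒≥ a⊀b) (a≼ u))))) u≢v
    ... | yes a≺b with a~b ← extremes⇒adjacent a≺b a≼ ≼b with inhabited? a b
    ...   | no gap = complete-intervals G λ {u} {v} → gap-clique a~b gap (a≼ u , ≼b u) (a≼ v , ≼b v)
    ...   | yes inhabited with c , (a≺c , c≺b) , a~c , c~b ← apex a~b inhabited =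
      -- Both sides of this triangle may continue. The corner opposite to each side serves as its
      -- `z`, and `pos c` and `pos b` are crude bounds on the lengths.
      join a~b (a≺c , c≺b) a~c c~b a≼ ≼b
        (strip (pos c) (ℕ.m≤m+n _ _) a≺c a~c (inj₂ c≺b) a~b c~b)
        (strip (pos b) (ℕ.m≤m+n _ _) c≺b c~b (inj₁ a≺c) (~-sym a~c) (~-sym a~b))

maximal⇒intervals : ∀ n (G : Graph n) → MaximalOuterplanar G → ¬ (S₃ IsInducedIn G) → IntervalModel G
maximal⇒intervals zero G _ _ = complete-intervals G λ { {()} }
maximal⇒intervals (suc n) G ((π , nonCrossing) , maximal) S₃-free =
  intervalModel (S₃-free⇒one-sided S₃-free) Fin.zero
  where open Triangulation G π nonCrossing maximal

theorem4p6 : (n : ℕ) (G : Graph n) → MaximalOuterplanar G → B₀ G ⇔ (¬ (S₃ IsInducedIn G))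
theorem4p6 n G mop = mk⇔ B₀⇒S₃-free (λ free → intervals⇒B₀ (maximal⇒intervals n G mop free))
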